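{- For every integer $n\ge 2$, the number of based bubbles of arity $n$ in the family $\mathcal{S}$ is $A(n-1)$. Equivalently, the number of unbased bubbles of arity $n$ in the family $\mathcal{S}$ is $A(n-1)$.
   Context: The sequence $A$ (OEIS A000975: $1,2,5,10,21,42,85,\dots$) is defined by $A(1)=1$, $A(2m)=2A(2m-1)$ and $A(2m+1)=2A(2m)+1$ for $m\ge 1$. A bubble is a polygon consisting of a distinguished base edge and two or more nonbase edges, with each edge either colored blue or left uncolored. The bubble is based if its base edge is blue, and unbased otherwise. The border of a bubble is its sequence of nonbase edges (read in order around the polygon from one end of the base to the other), and the arity of a bubble is the number of edges in its border. Two bubbles are the same if and only if their base edges have the same color and their borders are the same sequence of colors. The family $\mathcal{S}$ (the bubbles of the 2-colored suboperad, of the 2-colored operad of bubbles, generated by the all-blue triangle and the all-uncolored triangle) is described as follows. The based bubbles in $\mathcal{S}$ are exactly those obtained from the triangle with all three edges blue by a finite (possibly empty) sequence of moves, each of which either replaces one blue border edge by two consecutive uncolored border edges, or replaces one uncolored border edge by two consecutive blue border edges (the base edge is never changed). The unbased bubbles in $\mathcal{S}$ are exactly those obtained by the same moves from the triangle with all three edges uncolored. -}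

module Defs where

open import Level using (Level; _⊔_)
open import Data.List using (List; []; _∷_; _++_; length)
open import Data.List.Membership.Propositional using (_∈_)
open import Data.List.Relation.Unary.Unique.Propositional using (Unique)
open import Data.Nat using (ℕ; zero; suc; _+_; _*_; _∸_; _≤_; z≤n; s≤s; NonZero)
open import Data.Nat.DivMod using (_%_; m*n%n≡0; [m+kn]%n≡m%n)
open import Data.Nat.Properties using (*-comm; +-comm; +-identityʳ)
open import Data.Product using (_×_; ∃-syntax)
open import Data.Sum using (_⊎_)
open import Function.Bundles using (_⇔_)
open import Relation.Binary.Construct.Closure.ReflexiveTransitive using (Star)
open import Relation.Binary.PropositionalEquality
  using (_≡_; refl; trans; cong)
open import Relation.Unary using (Pred)

private
  variable
    a p : Level

-- A 0 is a conventional value extending the recurrence downwards; the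
-- recurrence in its usual form is A-one, A-even, A-odd.
A : ℕ → ℕ
A zero    = 0
A (suc n) = 2 * A n + suc n % 2

A-one : A 1 ≡ 1
A-one = refl

A-even : ∀ m .{{_ : NonZero m}} → A (2 * m) ≡ 2 * A (2 * m ∸ 1)
A-even m@(suc _) =
  trans (cong (2 * A (2 * m ∸ 1) +_)
          (trans (cong (_% 2) (*-comm 2 m)) (m*n%n≡0 m 2)))
        (+-identityʳ _)

A-odd : ∀ m → A (2 * m + 1) ≡ 2 * A (2 * m) + 1
A-odd m =
  trans (cong A (+-comm (2 * m) 1))
        (cong (2 * A (2 * m) +_)
          (trans (cong (λ k → suc k % 2) (*-comm 2 m)) ([m+kn]%n≡m%n 1 m 2)))

data Colour : Set where
  blue uncoloured : Colour

-- The arity bound is irrelevant, so two bubbles are equal exactly when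
-- their bases and their borders are.
record Bubble : Set where
  constructor bubble
  field
    base     : Colour
    border   : List Colour
    .2≤sides : 2 ≤ length border

open Bubble public

arity : Bubble → ℕ
arity b = length (border b)

Based : Bubble → Set
Based b = base b ≡ blue

Unbased : Bubble → Set
Unbased b = base b ≡ uncoloured

triangle : Colour → Bubble
triangle c = bubble c (c ∷ c ∷ []) (s≤s (s≤s z≤n))

infix 4 _⇝_ _⟶_ _⟶*_

data _⇝_ : List Colour → List Colour → Set where
  splitBlue : ∀ xs ys →
    xs ++ blue ∷ ys ⇝ xs ++ uncoloured ∷ uncoloured ∷ ys
  splitUncoloured : ∀ xs ys →
    xs ++ uncoloured ∷ ys ⇝ xs ++ blue ∷ blue ∷ ys

_⟶_ : Bubble → Bubble → Set
b ⟶ b′ = base b ≡ base b′ × border b ⇝ border b′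

_⟶*_ : Bubble → Bubble → Set
_⟶*_ = Star _⟶_

-- Moves preserve the base, so the based members of 𝒮 are those reached
-- from the blue triangle and the unbased ones those reached from the
-- uncoloured triangle.
𝒮 : Bubble → Set
𝒮 b = triangle blue ⟶* b ⊎ triangle uncoloured ⟶* b

BasedOfArity : ℕ → Bubble → Set
BasedOfArity n b = 𝒮 b × Based b × arity b ≡ n

UnbasedOfArity : ℕ → Bubble → Set
UnbasedOfArity n b = 𝒮 b × Unbased b × arity b ≡ n

-- Exactly k elements satisfy P: they can be listed without repetition
-- in a list of length k.  Proofs of P are not themselves counted.
HasCount : {X : Set a} → Pred X p → ℕ → Set (a ⊔ p)
HasCount P k = ∃[ xs ] Unique xs × (∀ x → x ∈ xs ⇔ P x) × length xs ≡ k

{-# OPTIONS --safe #-}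

-- Weigh a blue edge 1 and an uncoloured edge 2 modulo 3.  A move preserves the
-- weight of the border and creates two equal adjacent edges.  Conversely a
-- word of length at least 3 with two equal adjacent letters is constant or
-- contains c c d or d c c with c ≠ d, and undoing a move on c c leaves the pair
-- d d; a constant word can likewise be shortened unless it is c c c, which has
-- weight 0.  So the borders reached from c c are exactly the words with a pair
-- of equal adjacent letters whose weight is that of c c.
--
-- Such a word of length m + 2 is either a letter followed by another such word,
-- or an alternating word with its first letter repeated; exactly one word of
-- the second kind has any given nonzero weight, and none has weight 0.
module Submission where

open import Defs
open import Data.Nat using (ℕ; zero; suc; _+_; _*_; _≤_; _∸_; z≤n; s≤s)
open import Data.Nat.DivMod using (_%_)
open import Data.Nat.Properties using (+-comm; +-identityʳ; +-assoc; suc-injective; m≤n⇒m≤1+n)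
open import Data.Product using (_×_; _,_; proj₁; proj₂; ∃-syntax)
open import Data.Sum using (_⊎_; inj₁; inj₂)
open import Data.List using (List; []; _∷_; _++_; length; map)
open import Data.List.Properties using (length-map; length-++; ∷-injectiveʳ)
open import Data.List.Membership.Propositional using (_∈_)
open import Data.List.Membership.Propositional.Properties
  using (∈-map⁺; ∈-map⁻; ∈-++⁺ˡ; ∈-++⁺ʳ; ∈-++⁻)
open import Data.List.Relation.Binary.Disjoint.Propositional using (Disjoint)
open import Data.List.Relation.Unary.All as All using (All; []; _∷_)
open import Data.List.Relation.Unary.AllPairs using ([]; _∷_)
open import Data.List.Relation.Unary.Any using (here; there)
open import Data.List.Relation.Unary.Unique.Propositional using (Unique)
import Data.List.Relation.Unary.Unique.Propositional.Properties as Unique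
open import Data.Maybe using (Maybe; just; nothing)
open import Data.Maybe.Properties using (just-injective)
open import Function.Bundles using (mk⇔; Equivalence)
open import Level using (Level)
open import Relation.Binary.Construct.Closure.ReflexiveTransitive using (ε; _◅_; _◅◅_)
open import Relation.Binary.PropositionalEquality
open import Relation.Nullary using (¬_)
open import Relation.Unary using (Pred)

private
  variable
    a b p q : Level

-- Colours as the nonzero residues modulo 3.

-- On the weights 1 and 2, swapping the colours is negation modulo 3.
flip : Colour → Colour
flip blue       = uncoloured
flip uncoloured = blue

flip-involutive : ∀ c → flip (flip c) ≡ c
flip-involutive blue       = refl
flip-involutive uncoloured = refl

same-or-flip : ∀ c d → d ≡ c ⊎ d ≡ flip c
same-or-flip blue       blue       = inj₁ refl
same-or-flip blue       uncoloured = inj₂ refl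
same-or-flip uncoloured blue       = inj₂ refl
same-or-flip uncoloured uncoloured = inj₁ refl

-- The integers modulo 3: nothing is 0, just blue is 1, just uncoloured is 2.
Residue : Set
Residue = Maybe Colour

-- Addition modulo 3 of the weight of the given colour.
turn : Colour → Residue → Residue
turn c          nothing           = just c
turn blue       (just blue)       = just uncoloured
turn blue       (just uncoloured) = nothing
turn uncoloured (just blue)       = nothing
turn uncoloured (just uncoloured) = just blue

turn-flip : ∀ c r → turn (flip c) (turn c r) ≡ r
turn-flip blue       nothing           = refl
turn-flip blue       (just blue)       = refl
turn-flip blue       (just uncoloured) = refl
turn-flip uncoloured nothing           = refl
turn-flip uncoloured (just blue)       = refl
turn-flip uncoloured (just uncoloured) = refl

flip-turn : ∀ c r → turn c (turn (flip c) r) ≡ r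
flip-turn blue       = turn-flip uncoloured
flip-turn uncoloured = turn-flip blue

-- Modulo 3, doubling is negation; hence splitting an edge does not change the total weight.
turn-twice : ∀ c r → turn c (turn c r) ≡ turn (flip c) r
turn-twice blue       nothing           = refl
turn-twice blue       (just blue)       = refl
turn-twice blue       (just uncoloured) = refl
turn-twice uncoloured nothing           = refl
turn-twice uncoloured (just blue)       = refl
turn-twice uncoloured (just uncoloured) = refl

turn-thrice : ∀ c → turn c (turn c (turn c nothing)) ≡ nothing
turn-thrice blue       = refl
turn-thrice uncoloured = refl

turn-self : ∀ c → turn c (just c) ≡ just (flip c)
turn-self c = turn-twice c nothing

-- What a move preserves and what it creates.

weight : List Colour → Residue
weight []      = nothing
weight (c ∷ w) = turn c (weight w)

weight-⇝ : ∀ {v w} → v ⇝ w → weight w ≡ weight v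
weight-⇝ (splitBlue [] ys)             = turn-twice uncoloured (weight ys)
weight-⇝ (splitBlue (x ∷ xs) ys)       = cong (turn x) (weight-⇝ (splitBlue xs ys))
weight-⇝ (splitUncoloured [] ys)       = turn-twice blue (weight ys)
weight-⇝ (splitUncoloured (x ∷ xs) ys) = cong (turn x) (weight-⇝ (splitUncoloured xs ys))

data HasPair : List Colour → Set where
  here  : ∀ {c w} → HasPair (c ∷ c ∷ w)
  there : ∀ {c w} → HasPair w → HasPair (c ∷ w)

hasPair-⇝ : ∀ {v w} → v ⇝ w → HasPair w
hasPair-⇝ (splitBlue [] ys)             = here
hasPair-⇝ (splitBlue (x ∷ xs) ys)       = there (hasPair-⇝ (splitBlue xs ys))
hasPair-⇝ (splitUncoloured [] ys)       = here
hasPair-⇝ (splitUncoloured (x ∷ xs) ys) = there (hasPair-⇝ (splitUncoloured xs ys))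

-- Once `c` is a constructor, `flip c` computes and `here` is ruled out by unification.
hasPair-tail : ∀ c {w} → HasPair (c ∷ flip c ∷ w) → HasPair (flip c ∷ w)
hasPair-tail blue       (there p) = p
hasPair-tail uncoloured (there p) = p

hasPair⇒2≤length : ∀ {w} → HasPair w → 2 ≤ length w
hasPair⇒2≤length here      = s≤s (s≤s z≤n)
hasPair⇒2≤length (there p) = m≤n⇒m≤1+n (hasPair⇒2≤length p)

⇝-length : ∀ {v w} → v ⇝ w → length w ≡ suc (length v)
⇝-length (splitBlue [] ys)             = refl
⇝-length (splitBlue (x ∷ xs) ys)       = cong suc (⇝-length (splitBlue xs ys))
⇝-length (splitUncoloured [] ys)       = refl
⇝-length (splitUncoloured (x ∷ xs) ys) = cong suc (⇝-length (splitUncoloured xs ys))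

∷-⇝ : ∀ c {v w} → v ⇝ w → c ∷ v ⇝ c ∷ w
∷-⇝ c (splitBlue xs ys)       = splitBlue (c ∷ xs) ys
∷-⇝ c (splitUncoloured xs ys) = splitUncoloured (c ∷ xs) ys

-- Undoing moves, and reachability.

split : ∀ c w → c ∷ w ⇝ flip c ∷ flip c ∷ w
split blue       = splitBlue []
split uncoloured = splitUncoloured []

merge : ∀ c w → flip c ∷ w ⇝ c ∷ c ∷ w
merge blue       = split uncoloured
merge uncoloured = split blue

PairedPredecessor : List Colour → Set
PairedPredecessor w = ∃[ v ] v ⇝ w × HasPair v

∷-predecessor : ∀ c {w} → PairedPredecessor w → PairedPredecessor (c ∷ w)
∷-predecessor c (v , m , p) = c ∷ v , ∷-⇝ c m , there p

-- Follow the alternation up to the first pair `d d`. The letter before it is `flip d`, so merging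
-- the pair into `flip d` creates a new pair with that letter.
predecessor-≢ : ∀ c w → HasPair (flip c ∷ w) → PairedPredecessor (c ∷ flip c ∷ w)
predecessor-≢ blue       (uncoloured ∷ w) p         = _ , ∷-⇝ blue (split blue w) , here
predecessor-≢ uncoloured (blue ∷ w)       p         = _ , ∷-⇝ uncoloured (split uncoloured w) , here
predecessor-≢ blue       (blue ∷ w)       (there p) = ∷-predecessor blue (predecessor-≢ uncoloured w p)
predecessor-≢ uncoloured (uncoloured ∷ w) (there p) = ∷-predecessor uncoloured (predecessor-≢ blue w p)
predecessor-≢ blue       []               (there ())
predecessor-≢ uncoloured []               (there ())

-- With `d` opposite to `c`, merging `c c` gives a second `d`. If the word starts `c c c`, the
-- fourth letter decides which two to merge: the first two leave a later `c c` intact, the last two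
-- produce a pair with an opposite fourth letter.
predecessor-≡ : ∀ c d w → PairedPredecessor (c ∷ c ∷ d ∷ w) ⊎ weight (c ∷ c ∷ d ∷ w) ≡ nothing
predecessor-≡ c d w with same-or-flip c d
... | inj₂ refl = inj₁ (_ , merge c _ , here)
predecessor-≡ c .c []      | inj₁ refl = inj₂ (turn-thrice c)
predecessor-≡ c .c (e ∷ w) | inj₁ refl with same-or-flip c e
... | inj₁ refl = inj₁ (_ , merge c _ , there here)
... | inj₂ refl = inj₁ (_ , ∷-⇝ c (merge c _) , there here)

predecessor : ∀ c d e w → HasPair (c ∷ d ∷ e ∷ w) →
  PairedPredecessor (c ∷ d ∷ e ∷ w) ⊎ weight (c ∷ d ∷ e ∷ w) ≡ nothing
predecessor c d e w p with same-or-flip c d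
... | inj₁ refl = predecessor-≡ c e w
... | inj₂ refl = inj₁ (predecessor-≢ c (e ∷ w) (hasPair-tail c p))

just-flip-injective : ∀ {c d} → just (flip c) ≡ just (flip d) → c ≡ d
just-flip-injective {c} {d} eq =
  trans (sym (flip-involutive c)) (trans (cong flip (just-injective eq)) (flip-involutive d))

-- Induction on the length, carried by `n` because the predecessor is not a subterm of `w`; the
-- undone move is appended as the last one.
reachable : ∀ n c w .(l : 2 ≤ length w) → length w ≡ n →
  HasPair w → weight w ≡ just (flip c) → triangle c ⟶* bubble c w l
reachable n c (x ∷ .x ∷ []) l _ here eq
  with refl ← just-flip-injective {x} {c} (trans (sym (turn-self x)) eq) = ε
reachable n c (x ∷ y ∷ []) l _ (there (there ())) eq
reachable (suc n) c w@(x ∷ y ∷ z ∷ w′) l len p eq with predecessor x y z w′ p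
-- The weight of `c c` is nonzero, so the irreducible word `x x x` cannot occur.
... | inj₂ eq₀ with () ← trans (sym eq₀) eq
... | inj₁ (v , m , q) =
  reachable n c v (hasPair⇒2≤length q) (suc-injective (trans (sym (⇝-length m)) len)) q
    (trans (sym (weight-⇝ m)) eq)
  ◅◅ ((refl , m) ◅ ε)

Reached : Colour → Bubble → Set
Reached c x = base x ≡ c × HasPair (border x) × weight (border x) ≡ just (flip c)

reached-⟶* : ∀ {c x y} → Reached c x → x ⟶* y → Reached c y
reached-⟶* r ε = r
reached-⟶* (refl , p , eq) ((bases , m) ◅ ms) =
  reached-⟶* (sym bases , hasPair-⇝ m , trans (weight-⇝ m) eq) ms

reached-triangle : ∀ c → Reached c (triangle c)
reached-triangle c = refl , here , turn-self c

-- Alternating words with the first letter doubled.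

alternating : Colour → ℕ → List Colour
alternating c zero    = []
alternating c (suc n) = c ∷ alternating (flip c) n

length-alternating : ∀ c n → length (alternating c n) ≡ n
length-alternating c zero    = refl
length-alternating c (suc n) = cong suc (length-alternating (flip c) n)

¬hasPair-alternating : ∀ c n → ¬ HasPair (alternating c n)
¬hasPair-alternating blue       (suc (suc n)) (there p) = ¬hasPair-alternating uncoloured (suc n) p
¬hasPair-alternating uncoloured (suc (suc n)) (there p) = ¬hasPair-alternating blue (suc n) p
¬hasPair-alternating c          (suc zero)    (there ())

hasPair-or-alternating : ∀ c w → HasPair (c ∷ w) ⊎ w ≡ alternating (flip c) (length w)
hasPair-or-alternating c [] = inj₂ refl
hasPair-or-alternating c (d ∷ w) with same-or-flip c d | hasPair-or-alternating d w
... | inj₁ refl | _       = inj₁ here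
... | inj₂ refl | inj₁ p  = inj₁ (there p)
... | inj₂ refl | inj₂ eq = inj₂ (cong (flip c ∷_) eq)

stutter : Colour → ℕ → List Colour
stutter c m = c ∷ alternating c (suc m)

-- If the pair is at the front and the tail contains none, the tail must alternate.
hasPair-∷ : ∀ {c m w} → length w ≡ suc m → HasPair (c ∷ w) → HasPair w ⊎ c ∷ w ≡ stutter c m
hasPair-∷ len (there p) = inj₁ p
hasPair-∷ {c} {m} {.c ∷ w} len here with hasPair-or-alternating c w
... | inj₁ p  = inj₁ p
... | inj₂ eq = inj₂ (cong (λ v → c ∷ c ∷ v)
                  (trans eq (cong (alternating (flip c)) (suc-injective len))))

-- The map from the first letter of a stutter to its weight. Being an involution, it also recovers
-- the letter from the weight.
flips : ℕ → Colour → Colour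
flips zero    c = flip c
flips (suc m) c = flip (flips m c)

flips-flip : ∀ m c → flips m (flip c) ≡ flip (flips m c)
flips-flip zero    c = refl
flips-flip (suc m) c = cong flip (flips-flip m c)

flips-involutive : ∀ m c → flips m (flips m c) ≡ c
flips-involutive zero    c = flip-involutive c
flips-involutive (suc m) c = begin
  flip (flips m (flip (flips m c))) ≡⟨ cong flip (flips-flip m (flips m c)) ⟩
  flip (flip (flips m (flips m c))) ≡⟨ flip-involutive _ ⟩
  flips m (flips m c)               ≡⟨ flips-involutive m c ⟩
  c                                 ∎
  where open ≡-Reasoning

-- Merging the doubled `c` into `flip c` keeps the weight and leaves a stutter on `flip c` that is
-- one letter shorter.
weight-stutter : ∀ m c → weight (stutter c m) ≡ just (flips m c)
weight-stutter zero    c = turn-self c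
weight-stutter (suc m) c = begin
  turn c (turn c (weight (alternating (flip c) (suc m)))) ≡⟨ turn-twice c _ ⟩
  weight (stutter (flip c) m)                             ≡⟨ weight-stutter m (flip c) ⟩
  just (flips m (flip c))                                 ≡⟨ cong just (flips-flip m c) ⟩
  just (flip (flips m c))                                 ∎
  where open ≡-Reasoning

-- Enumeration of the words with a pair, by length and weight.

stutters : ℕ → Residue → List (List Colour)
stutters m nothing  = []
stutters m (just c) = stutter (flips m c) m ∷ []

-- Indexed so that the words in paired m r have length suc m.
paired : ℕ → Residue → List (List Colour)
extended : ℕ → Residue → Colour → List (List Colour)

paired zero    r = []
paired (suc m) r = stutters m r ++ extended m r blue ++ extended m r uncoloured

extended m r c = map (c ∷_) (paired m (turn (flip c) r))

Paired : ℕ → Residue → List Colour → Set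
Paired n r w = length w ≡ n × HasPair w × weight w ≡ r

stutters-sound : ∀ m r {w} → w ∈ stutters m r → Paired (suc (suc m)) r w × ∃[ c ] w ≡ stutter c m
stutters-sound m (just c) (here refl) =
  ( cong (λ k → suc (suc k)) (length-alternating (flip (flips m c)) m)
  , here
  , trans (weight-stutter m (flips m c)) (cong just (flips-involutive m c))
  ) , _ , refl

paired-sound : ∀ m r {w} → w ∈ paired m r → Paired (suc m) r w
extended-sound : ∀ m r c {w} → w ∈ extended m r c →
  ∃[ v ] w ≡ c ∷ v × Paired (suc m) (turn (flip c) r) v
extended-paired : ∀ m r c {w} → w ∈ extended m r c → Paired (suc (suc m)) r w

paired-sound (suc m) r w∈ with ∈-++⁻ (stutters m r) w∈
... | inj₁ w∈′ = proj₁ (stutters-sound m r w∈′)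
... | inj₂ w∈′ with ∈-++⁻ (extended m r blue) w∈′
...   | inj₁ w∈″ = extended-paired m r blue w∈″
...   | inj₂ w∈″ = extended-paired m r uncoloured w∈″

extended-sound m r c w∈ with v , v∈ , eq ← ∈-map⁻ (c ∷_) w∈ = v , eq , paired-sound m _ v∈

extended-paired m r c w∈ with v , refl , len , p , eq ← extended-sound m r c w∈ =
  cong suc len , there p , trans (cong (turn c) eq) (flip-turn c r)

∈-extended : ∀ m r c {w} → w ∈ extended m r c → w ∈ paired (suc m) r
∈-extended m r blue       w∈ = ∈-++⁺ʳ (stutters m r) (∈-++⁺ˡ w∈)
∈-extended m r uncoloured w∈ = ∈-++⁺ʳ (stutters m r) (∈-++⁺ʳ (extended m r blue) w∈)

paired-complete : ∀ m r {w} → Paired (suc m) r w → w ∈ paired m r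
paired-complete zero    r {x ∷ []} (_ , there () , _)
paired-complete (suc m) r {c ∷ w} (len , p , refl) with hasPair-∷ (suc-injective len) p
... | inj₁ q = ∈-extended m r c (∈-map⁺ (c ∷_)
                 (paired-complete m _ (suc-injective len , q , sym (turn-flip c (weight w)))))
-- The rewrites turn the letter selected by `stutters` into `flips m (flips m c)` and then into `c`.
... | inj₂ refl rewrite weight-stutter m c | flips-involutive m c = here refl

stutters-unique : ∀ m r → Unique (stutters m r)
stutters-unique m nothing  = []
stutters-unique m (just c) = [] ∷ []

extended-disjoint : ∀ m r → Disjoint (extended m r blue) (extended m r uncoloured)
extended-disjoint m r (w∈ , w∈′)
  with _ , refl , _ ← extended-sound m r blue w∈
  with _ , () , _ ← extended-sound m r uncoloured w∈′

-- The tail of a stutter alternates, whereas the tail of an extended word has a pair.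
stutters-extended-disjoint : ∀ m r c {w} → w ∈ stutters m r → ¬ w ∈ extended m r c
stutters-extended-disjoint m r c w∈ w∈′
  with _ , d , refl ← stutters-sound m r w∈
  with _ , eq , _ , p , _ ← extended-sound m r c w∈′ =
  ¬hasPair-alternating d (suc m) (subst HasPair (sym (∷-injectiveʳ eq)) p)

paired-unique : ∀ m r → Unique (paired m r)
paired-unique zero    r = []
paired-unique (suc m) r =
  Unique.++⁺ (stutters-unique m r)
    (Unique.++⁺ (extended-unique blue) (extended-unique uncoloured) (extended-disjoint m r))
    disjoint
  where
  extended-unique : ∀ c → Unique (extended m r c)
  extended-unique c = Unique.map⁺ ∷-injectiveʳ (paired-unique m _)

  disjoint : Disjoint (stutters m r) (extended m r blue ++ extended m r uncoloured)
  disjoint (w∈ , w∈′) with ∈-++⁻ (extended m r blue) w∈′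
  ... | inj₁ w∈″ = stutters-extended-disjoint m r blue w∈ w∈″
  ... | inj₂ w∈″ = stutters-extended-disjoint m r uncoloured w∈ w∈″

-- Counting the enumerated words.

length-paired-suc : ∀ m r → length (paired (suc m) r) ≡
  length (stutters m r) + (length (paired m (turn uncoloured r)) + length (paired m (turn blue r)))
length-paired-suc m r = begin
  length (stutters m r ++ extended m r blue ++ extended m r uncoloured)
    ≡⟨ length-++ (stutters m r) ⟩
  length (stutters m r) + length (extended m r blue ++ extended m r uncoloured)
    ≡⟨ cong (length (stutters m r) +_) (length-++ (extended m r blue)) ⟩
  length (stutters m r) + (length (extended m r blue) + length (extended m r uncoloured))
    ≡⟨ cong (length (stutters m r) +_) (cong₂ _+_ (length-map _ (paired m _)) (length-map _ (paired m _))) ⟩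
  length (stutters m r) + (length (paired m (turn uncoloured r)) + length (paired m (turn blue r))) ∎
  where open ≡-Reasoning

-- The number of words in `paired m nothing`: there is no stutter of weight 0, and each first letter
-- precedes a tail of nonzero weight.
zeroCount : ℕ → ℕ
zeroCount zero    = 0
zeroCount (suc m) = 2 * A m

consecutive-parities : ∀ m → m % 2 + suc m % 2 ≡ 1
consecutive-parities zero          = refl
consecutive-parities (suc zero)    = refl
consecutive-parities (suc (suc m)) = consecutive-parities m

-- Thus `zeroCount m` equals `A m` for even `m` and is one less for odd `m`.
suc-zeroCount : ∀ m → suc (zeroCount m) ≡ A m + suc m % 2
suc-zeroCount zero    = refl
suc-zeroCount (suc m) = begin
  1 + 2 * A m                                 ≡⟨ +-comm 1 (2 * A m) ⟩
  2 * A m + 1                                 ≡⟨ cong (2 * A m +_) (consecutive-parities (suc m)) ⟨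
  2 * A m + (suc m % 2 + suc (suc m) % 2)     ≡⟨ +-assoc (2 * A m) _ _ ⟨
  2 * A m + suc m % 2 + suc (suc m) % 2       ∎
  where open ≡-Reasoning

-- The left side counts a nonzero weight: one stutter, then the tails of weight 0 and those of the
-- opposite nonzero weight.
A-suc : ∀ m → suc (zeroCount m + A m) ≡ A (suc m)
A-suc m = begin
  suc (zeroCount m) + A m     ≡⟨ cong (_+ A m) (suc-zeroCount m) ⟩
  A m + suc m % 2 + A m       ≡⟨ +-comm _ (A m) ⟩
  A m + (A m + suc m % 2)     ≡⟨ +-assoc (A m) _ _ ⟨
  A m + A m + suc m % 2       ≡⟨ cong (λ k → A m + k + suc m % 2) (+-identityʳ (A m)) ⟨
  2 * A m + suc m % 2         ∎
  where open ≡-Reasoning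

length-paired-nothing : ∀ m → length (paired m nothing) ≡ zeroCount m
length-paired-just : ∀ m c → length (paired m (just c)) ≡ A m

length-paired-nothing zero    = refl
length-paired-nothing (suc m) = trans (length-paired-suc m nothing)
  (cong₂ _+_ (length-paired-just m uncoloured)
    (trans (length-paired-just m blue) (sym (+-identityʳ (A m)))))

-- A one-letter word has no pair, in agreement with the convention for `A 0`.
length-paired-just zero    c          = refl
length-paired-just (suc m) blue       = trans (length-paired-suc m (just blue))
  (trans (cong suc (cong₂ _+_ (length-paired-nothing m) (length-paired-just m uncoloured))) (A-suc m))
length-paired-just (suc m) uncoloured = trans (length-paired-suc m (just uncoloured))
  (trans (cong suc (trans (cong₂ _+_ (length-paired-just m blue) (length-paired-nothing m))
    (+-comm (A m) (zeroCount m)))) (A-suc m))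

count-paired : ∀ m c → HasCount (Paired (suc m) (just c)) (A m)
count-paired m c =
  paired m (just c) , paired-unique m (just c) ,
  (λ w → mk⇔ (paired-sound m (just c)) (paired-complete m (just c))) ,
  length-paired-just m c

-- From counting borders to counting bubbles.

lift-list : {X : Set a} {Y : Set b} {Q : Pred Y q} (g : Y → X) {xs : List X} →
  All (λ x → ∃[ y ] Q y × g y ≡ x) xs → ∃[ ys ] map g ys ≡ xs × All Q ys
lift-list g []                    = [] , refl , []
lift-list g ((y , q , refl) ∷ as) with ys , refl , qs ← lift-list g as = y ∷ ys , refl , q ∷ qs

-- Choose a preimage of each listed element: these are distinct because their images are, and
-- injectivity on `Q` shows that no other element satisfies `Q`.
hasCount-injection : {X : Set a} {Y : Set b} {P : Pred X p} {Q : Pred Y q} {k : ℕ} (g : Y → X) →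
  (∀ {y} → Q y → P (g y)) →
  (∀ {y z} → Q y → Q z → g y ≡ g z → y ≡ z) →
  (∀ {x} → P x → ∃[ y ] Q y × g y ≡ x) →
  HasCount P k → HasCount Q k
hasCount-injection {Q = Q} g into injective onto (xs , unique , listed , len)
  with ys , refl , qs ← lift-list {Q = Q} g
         (All.tabulate (λ {x} x∈ → onto (Equivalence.to (listed x) x∈))) =
  ys , Unique.map⁻ unique , (λ y → mk⇔ (All.lookup qs) complete) , trans (sym (length-map g ys)) len
  where
  complete : ∀ {y} → Q y → y ∈ ys
  complete qy with z , z∈ , eq ← ∈-map⁻ g (Equivalence.from (listed _) (into qy)) =
    subst (_∈ ys) (sym (injective qy (All.lookup qs z∈) eq)) z∈

OfArity : Colour → ℕ → Bubble → Set
OfArity c n x = 𝒮 x × base x ≡ c × arity x ≡ n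

𝒮-reached : ∀ {x} → 𝒮 x → Reached (base x) x
𝒮-reached (inj₁ ms) with r@(refl , _) ← reached-⟶* (reached-triangle blue) ms = r
𝒮-reached (inj₂ ms) with r@(refl , _) ← reached-⟶* (reached-triangle uncoloured) ms = r

triangle-𝒮 : ∀ c {x} → triangle c ⟶* x → 𝒮 x
triangle-𝒮 blue       = inj₁
triangle-𝒮 uncoloured = inj₂

-- With the base fixed, the border determines the bubble. The weight `flip c` is that of the
-- triangle's border `c c`.
count-ofArity : ∀ c m → HasCount (OfArity c (suc m)) (A m)
count-ofArity c m = hasCount-injection border into injective onto (count-paired m (flip c))
  where
  into : ∀ {x} → OfArity c (suc m) x → Paired (suc m) (just (flip c)) (border x)
  into (s , refl , len) with _ , p , eq ← 𝒮-reached s = len , p , eq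

  injective : ∀ {x y} → OfArity c (suc m) x → OfArity c (suc m) y → border x ≡ border y → x ≡ y
  injective (_ , refl , _) (_ , refl , _) refl = refl

  onto : ∀ {w} → Paired (suc m) (just (flip c)) w → ∃[ x ] OfArity c (suc m) x × border x ≡ w
  onto {w} (len , p , eq) =
    bubble c w l , (triangle-𝒮 c (reachable (suc m) c w l len p eq) , refl , len) , refl
    where
    l : 2 ≤ length w
    l = hasPair⇒2≤length p

theorem5p2 : ∀ (n : ℕ) → 2 ≤ n →
    HasCount (BasedOfArity n) (A (n ∸ 1)) × HasCount (UnbasedOfArity n) (A (n ∸ 1))
theorem5p2 (suc m) _ = count-ofArity blue m , count-ofArity uncoloured m
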